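{- For any graph $D$ (loops allowed), consider the following properties. (a) There exists a constant $0<a<1$ such that for any $q$ large enough, $p_2[D,q]\ge a$. (b) There exists a constant $0<b<1$ such that for any $q$ large enough, $p_0[D,q]\ge b$. (c) There exists a constant $0<c<1$ such that for any $q$ large enough, $p_1[D,q]\le c$. (d) There exists a constant $d>0$ such that for any $q$ large enough, $$\frac{1}{|\mathrm{F}[D,q]|}\sum_{f\in\mathrm{F}[D,q]}\mathrm{i}(f)\ge d.$$ Then (a) implies (b), and (b), (c), (d) are equivalent.
   Context: Graphs are finite and directed: $D=(V,E)$ with $V=\{1,\dots,n\}$, $n\ge1$, $E\subseteq V^2$. For an integer $q\ge2$ let $[q]=\{0,\dots,q-1\}$. For $f=(f_1,\dots,f_n):[q]^n\to[q]^n$, the interaction graph $G(f)$ has vertex set $V$ and an arc $(u,v)$ if and only if there exist $x,y\in[q]^n$ differing only in coordinate $u$ with $f_v(x)\ne f_v(y)$. $\mathrm{F}[D,q]$ is the set of all $f:[q]^n\to[q]^n$ with $G(f)=D$. Let $\mathrm{Fix}(f)$ be the set of fixed points of $f$. Then $p_0[D,q]$, $p_1[D,q]$, $p_2[D,q]$ are the proportions of $f\in\mathrm{F}[D,q]$ with $|\mathrm{Fix}(f)|=0$, $|\mathrm{Fix}(f)|=1$, $|\mathrm{Fix}(f)|\ge2$ respectively. With $d_{\mathrm H}$ the Hamming distance, $\mathrm{i}(f)=\min_{x\in[q]^n}d_{\mathrm H}(x,f(x))$. -}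

module Defs where

open import Data.Bool using (Bool)
import Data.Bool.Properties as Bool
open import Data.Fin using (Fin; finToFun; funToFin)
open import Data.Fin.Properties using (_≟_; any?; all?; finToFun-funToFin)
open import Data.Integer using (+_)
open import Data.List using (List; length; map; filter; allFin)
open import Data.List.Extrema.Nat using (min)
open import Data.Nat as ℕ using (ℕ; zero; suc; _^_)
open import Data.Nat.ListAction using (sum)
open import Data.Product using (∃; ∃₂; _×_; _,_)
open import Data.Rational as ℚ using (ℚ; 0ℚ)
open import Data.Vec using (Vec; lookup; tabulate)
open import Data.Vec.Properties using (≡-dec; tabulate-cong; tabulate∘lookup)
open import Function using (_∘_)
open import Level using (0ℓ)
open import Relation.Binary.PropositionalEquality
  using (_≡_; _≢_; sym; trans; subst)
open import Relation.Nullary using (Dec; does; ¬?; _×-dec_; _→-dec_)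
open import Relation.Nullary.Decidable using (map′)
open import Relation.Unary using (Pred; Decidable)

-- A directed graph on Fin n, loops allowed, given by its adjacency matrix:
-- D u v ≡ true means that (u , v) is an arc.
Digraph : ℕ → Set
Digraph n = Fin n → Fin n → Bool

State : ℕ → ℕ → Set
State q n = Vec (Fin q) n

Network : ℕ → ℕ → Set
Network q n = State q n → State q n

module _ {q n : ℕ} where

  -- The library bijection between Fin (q ^ n) and the functions
  -- Fin n → Fin q, transported to vectors.
  encode : State q n → Fin (q ^ n)
  encode x = funToFin (lookup x)

  decode : Fin (q ^ n) → State q n
  decode i = tabulate (finToFun i)

  decode-encode : ∀ x → decode (encode x) ≡ x
  decode-encode x =
    trans (tabulate-cong (finToFun-funToFin (lookup x))) (tabulate∘lookup x)

  ∃-State? : {P : Pred (State q n) 0ℓ} → Decidable P → Dec (∃ P)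
  ∃-State? {P} P? =
    map′ (λ (i , p) → decode i , p)
         (λ (x , p) → encode x , subst P (sym (decode-encode x)) p)
         (any? (λ i → P? (decode i)))

  _≟ˢ_ : (x y : State q n) → Dec (x ≡ y)
  _≟ˢ_ = ≡-dec _≟_

  DifferOnlyIn : Fin n → State q n → State q n → Set
  DifferOnlyIn u x y =
    lookup x u ≢ lookup y u × (∀ w → w ≢ u → lookup x w ≡ lookup y w)

  differOnlyIn? : ∀ u x y → Dec (DifferOnlyIn u x y)
  differOnlyIn? u x y =
    ¬? (lookup x u ≟ lookup y u) ×-dec
    all? (λ w → ¬? (w ≟ u) →-dec (lookup x w ≟ lookup y w))

  InteractionArc : Network q n → Fin n → Fin n → Set
  InteractionArc f u v =
    ∃₂ λ x y → DifferOnlyIn u x y × lookup (f x) v ≢ lookup (f y) v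

  interactionArc? : ∀ f u v → Dec (InteractionArc f u v)
  interactionArc? f u v =
    ∃-State? λ x → ∃-State? λ y →
      differOnlyIn? u x y ×-dec ¬? (lookup (f x) v ≟ lookup (f y) v)

  interactionGraph : Network q n → Digraph n
  interactionGraph f u v = does (interactionArc? f u v)

  HasGraph : Digraph n → Network q n → Set
  HasGraph D f = ∀ u v → interactionGraph f u v ≡ D u v

  hasGraph? : ∀ D f → Dec (HasGraph D f)
  hasGraph? D f = all? λ u → all? λ v → interactionGraph f u v Bool.≟ D u v

-- Every state occurs exactly once.
states : ∀ q n → List (State q n)
states q n = map decode (allFin (q ^ n))

-- Every network occurs exactly once up to pointwise equality: the codes are
-- in bijection with the functions Fin (q ^ n) → Fin (q ^ n), i.e. with the
-- functions from encoded states to encoded states.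
networks : ∀ q n → List (Network q n)
networks q n =
  map (λ φ → decode ∘ finToFun φ ∘ encode) (allFin ((q ^ n) ^ (q ^ n)))

F[_,_] : ∀ {n} → Digraph n → (q : ℕ) → List (Network q n)
F[_,_] {n} D q = filter (hasGraph? D) (networks q n)

module _ {q n : ℕ} where

  Fix : Network q n → List (State q n)
  Fix f = filter (λ x → f x ≟ˢ x) (states q n)

  ∣Fix∣ : Network q n → ℕ
  ∣Fix∣ f = length (Fix f)

  d-H : State q n → State q n → ℕ
  d-H x y = length (filter (λ v → ¬? (lookup x v ≟ lookup y v)) (allFin n))

  -- The first argument of min is its value on the empty list. It does not
  -- affect the result for q ≥ 1, since there are states and d-H is at most n.
  i : Network q n → ℕ
  i f = min n (map (λ x → d-H x (f x)) (states q n))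

-- The quotient of two naturals, with the convention that k / 0 is 0. Below,
-- the denominator is the length of F[ D , q ], which is never 0 for q ≥ 2:
-- the network sending x at v to 1 if x is nonzero at all in-neighbours of v,
-- and to 0 otherwise, has interaction graph D.
quotient : ℕ → ℕ → ℚ
quotient k zero    = 0ℚ
quotient k (suc m) = + k ℚ./ suc m

module _ {n : ℕ} (D : Digraph n) (q : ℕ) where

  proportion : {P : Pred (Network q n) 0ℓ} → Decidable P → ℚ
  proportion P? = quotient (length (filter P? F[ D , q ])) (length F[ D , q ])

  p₀ p₁ p₂ : ℚ
  p₀ = proportion (λ f → ∣Fix∣ f ℕ.≟ 0)
  p₁ = proportion (λ f → ∣Fix∣ f ℕ.≟ 1)
  p₂ = proportion (λ f → 2 ℕ.≤? ∣Fix∣ f)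

  mean-i : ℚ
  mean-i = quotient (sum (map i F[ D , q ])) (length F[ D , q ])

-- Alphabets always have at least two letters.
ForLarge : (ℕ → Set) → Set
ForLarge P = ∃ λ Q → ∀ q → 2 ℕ.≤ q → Q ℕ.≤ q → P q

-- The constants below are rational. Since every positive real has a positive
-- rational below it, and every real less than 1 a rational less than 1 above
-- it, this is no stronger than asking for real constants.
module _ {n : ℕ} (D : Digraph n) where

  Property-a : Set
  Property-a = ∃ λ a → 0ℚ ℚ.< a × a ℚ.< ℚ.1ℚ × ForLarge (λ q → p₂ D q ℚ.≥ a)

  Property-b : Set
  Property-b = ∃ λ b → 0ℚ ℚ.< b × b ℚ.< ℚ.1ℚ × ForLarge (λ q → p₀ D q ℚ.≥ b)

  Property-c : Set
  Property-c = ∃ λ c → 0ℚ ℚ.< c × c ℚ.< ℚ.1ℚ × ForLarge (λ q → p₁ D q ℚ.≤ c)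

  Property-d : Set
  Property-d = ∃ λ d → 0ℚ ℚ.< d × ForLarge (λ q → mean-i D q ℚ.≥ d)

{-# OPTIONS --safe #-}
-- The networks with graph D have exactly one fixed point on average:
-- composing every coordinate of the output with a permutation of the alphabet
-- preserves the interaction graph, so the value f z at a given state z is
-- uniformly distributed and equals z with probability 1 / qⁿ.  Hence
-- p₁ + 2 p₂ ≤ 1 = p₀ + p₁ + p₂, that is, p₂ ≤ p₀ for every q.  This gives (a) ⇒ (b),
-- and 2 p₀ ≥ p₀ + p₂ = 1 - p₁ gives (c) ⇒ (b).  Finally (b) ⇔ (d) because i f
-- vanishes when f has a fixed point and is between 1 and n otherwise.
module Submission where

open import Defs

import Algebra.Properties.CommutativeMonoid.Sum as Sum
import Algebra.Properties.Semiring.Sum as SemiringSum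
open import Data.Bool using (Bool; true; false; if_then_else_)
import Data.Bool.Properties as Bool
open import Data.Fin using (Fin; zero; suc; finToFun; funToFin; combine)
open import Data.Fin.Permutation using (Permutation; permutation; _⟨$⟩ʳ_)
open import Data.Fin.Permutation.Components using (transpose; transpose-inverse)
open import Data.Fin.Properties
  using (_≟_; any?; finToFun-funToFin; funToFin-finToFin)
open import Data.Integer as ℤ using (+_)
import Data.Integer.Properties as ℤ
open import Data.List as List using (List; []; _∷_; length; map; filter; allFin)
open import Data.List.Extrema.Nat using (min≤v⁺; min≤⊤; v≤min⁺)
open import Data.List.Membership.Propositional using (lose)
open import Data.List.Membership.Propositional.Properties using (∈-allFin)
open import Data.List.Properties using (filter-none; filter-some; map-tabulate)
import Data.List.Relation.Unary.All as All
import Data.List.Relation.Unary.All.Properties as All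
import Data.List.Relation.Unary.Any as Any
import Data.List.Relation.Unary.Any.Properties as Any
open import Data.Nat as ℕ using (ℕ; zero; suc; _+_; _*_; _^_; _≤_; _<_; z≤n; s≤s; NonZero)
open import Data.Nat.ListAction using (sum)
import Data.Nat.Properties as ℕ
open import Data.Product using (∃; _×_; _,_)
open import Data.Rational as ℚ using (ℚ; 0ℚ; 1ℚ; ½)
import Data.Rational.Properties as ℚ
open import Data.Rational.Solver using (module +-*-Solver)
open import Data.Rational.Unnormalised as ℚᵘ using (mkℚᵘ; *≤*; *≡*)
import Data.Rational.Unnormalised.Properties as ℚᵘ
open import Data.Sum using (inj₁; inj₂)
open import Data.Vec using (lookup; tabulate; replicate; _[_]≔_)
open import Data.Vec.Properties
  using (lookup∘tabulate; lookup-replicate; lookup∘update; lookup∘update′;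
         tabulate-cong; tabulate∘lookup)
open import Function using (_∘_; id)
open import Function.Bundles using (_⇔_; mk⇔; Equivalence)
open import Function.Construct.Symmetry using (⇔-sym)
open import Level using (0ℓ)
open import Relation.Binary.PropositionalEquality
  using (_≡_; _≢_; _≗_; refl; sym; trans; cong; cong₂; subst; module ≡-Reasoning)
open import Relation.Nullary using (Dec; yes; no; does; ¬_; ¬?; contradiction; _×-dec_)
open import Relation.Nullary.Decidable using (does-⇔; dec-true; dec-false)
open import Relation.Unary using (Pred; Decidable)

open Sum ℕ.+-0-commutativeMonoid
  using (sum-syntax; sum-cong-≗; ∑-comm; ∑-permute)
open SemiringSum ℕ.+-*-semiring using (*-distribˡ-sum)

open +-*-Solver using (solve; con; _:+_; _:*_; _:-_; _:=_)

private
  variable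
    A P Q : Set
    m n q : ℕ

-- Indicators and finite sums.

𝟙 : Dec P → ℕ
𝟙 P? = if does P? then 1 else 0

𝟙-cong : P ⇔ Q → (P? : Dec P) (Q? : Dec Q) → 𝟙 P? ≡ 𝟙 Q?
𝟙-cong P⇔Q P? Q? = cong (if_then 1 else 0) (does-⇔ P⇔Q P? Q?)

length-filter-𝟙 : {P : Pred A 0ℓ} (P? : Decidable P) (xs : List A) →
                  length (filter P? xs) ≡ sum (map (λ x → 𝟙 (P? x)) xs)
length-filter-𝟙 P? [] = refl
length-filter-𝟙 P? (x ∷ xs) with does (P? x)
... | true  = cong suc (length-filter-𝟙 P? xs)
... | false = length-filter-𝟙 P? xs

sum-filter-𝟙 : {P : Pred A 0ℓ} (P? : Decidable P) (g : A → ℕ) (xs : List A) →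
               sum (map g (filter P? xs)) ≡ sum (map (λ x → 𝟙 (P? x) * g x) xs)
sum-filter-𝟙 P? g [] = refl
sum-filter-𝟙 P? g (x ∷ xs) with does (P? x)
... | true  = cong₂ _+_ (sym (ℕ.+-identityʳ (g x))) (sum-filter-𝟙 P? g xs)
... | false = sum-filter-𝟙 P? g xs

-- Moves list sums to `∑` over `Fin n`, where `∑-permute` and `∑-comm` apply.
sum-map-allFin : (g : A → ℕ) (h : Fin n → A) →
                 sum (map g (map h (allFin n))) ≡ ∑[ j < n ] g (h j)
sum-map-allFin {n = n} g h =
  trans (cong (sum ∘ map g) (map-tabulate id h))
        (trans (cong sum (map-tabulate h g)) (sum-tabulate (g ∘ h)))
  where
  sum-tabulate : ∀ {n} (f : Fin n → ℕ) → sum (List.tabulate f) ≡ ∑[ j < n ] f j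
  sum-tabulate {zero}  f = refl
  sum-tabulate {suc n} f = cong (f zero ℕ.+_) (sum-tabulate (f ∘ suc))

∑-const : ∀ n c → ∑[ j < n ] c ≡ n * c
∑-const zero    c = refl
∑-const (suc n) c = cong (c ℕ.+_) (∑-const n c)

∑-𝟙-≟ : (i : Fin n) → ∑[ j < n ] 𝟙 (i ≟ j) ≡ 1
∑-𝟙-≟ {suc n} zero    = cong suc (trans (∑-const n 0) (ℕ.*-zeroʳ n))
∑-𝟙-≟ {suc n} (suc i) = ∑-𝟙-≟ i

-- Codes of states and networks, and invariance of the interaction graph.

funToFin-cong : {f g : Fin m → Fin n} → f ≗ g → funToFin f ≡ funToFin g
funToFin-cong {zero}  f≗g = refl
funToFin-cong {suc m} f≗g = cong₂ combine (f≗g zero) (funToFin-cong (f≗g ∘ suc))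

encode-decode : (j : Fin (q ^ n)) → encode {q} {n} (decode j) ≡ j
encode-decode {q} {n} j =
  trans (funToFin-cong {n} {q} (lookup∘tabulate (finToFun {q} {n} j)))
        (funToFin-finToFin {n} {q} j)

∑-𝟙-decode : (s : State q n) → ∑[ j < q ^ n ] 𝟙 (s ≟ˢ decode j) ≡ 1
∑-𝟙-decode {q} {n} s =
  trans (sum-cong-≗ λ j → 𝟙-cong (s≡decode⇔ j) (s ≟ˢ decode j) (encode s ≟ j))
        (∑-𝟙-≟ (encode s))
  where
  s≡decode⇔ : ∀ j → s ≡ decode j ⇔ encode s ≡ j
  s≡decode⇔ j = mk⇔ (λ s≡ → trans (cong encode s≡) (encode-decode {q} {n} j))
                    (λ e → trans (sym (decode-encode s)) (cong decode e))

arc-map : {f g : Network q n} {u v : Fin n} →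
          (∀ x y → lookup (g x) v ≡ lookup (g y) v → lookup (f x) v ≡ lookup (f y) v) →
          InteractionArc f u v → InteractionArc g u v
arc-map g≡⇒f≡ (x , y , x∼y , f≢) = x , y , x∼y , f≢ ∘ g≡⇒f≡ x y

-- Arcs into `v` depend only on which pairs of states get equal values at `v`, not on the values
-- themselves. Hence an injective relabelling of the outputs in each coordinate keeps the graph, and
-- so does passing to a pointwise equal network.
hasGraph-cong : (D : Digraph n) (f g : Network q n) →
                (∀ v x y → lookup (f x) v ≡ lookup (f y) v ⇔ lookup (g x) v ≡ lookup (g y) v) →
                HasGraph D f ⇔ HasGraph D g
hasGraph-cong D f g f⇔g =
  mk⇔ (λ h u v → trans (sym (same u v)) (h u v)) (λ h u v → trans (same u v) (h u v))
  where
  same : ∀ u v → interactionGraph f u v ≡ interactionGraph g u v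
  same u v = does-⇔ (mk⇔ (arc-map {f = f} {g} (λ x y → Equivalence.from (f⇔g v x y)))
                         (arc-map {f = g} {f} (λ x y → Equivalence.to (f⇔g v x y))))
                    (interactionArc? f u v) (interactionArc? g u v)

network : Fin ((q ^ n) ^ (q ^ n)) → Network q n
network φ = decode ∘ finToFun φ ∘ encode

code : Network q n → Fin ((q ^ n) ^ (q ^ n))
code f = funToFin (encode ∘ f ∘ decode)

network-code : (f : Network q n) (x : State q n) → network (code f) x ≡ f x
network-code f x =
  trans (cong decode (finToFun-funToFin (encode ∘ f ∘ decode) (encode x)))
        (trans (decode-encode _) (cong f (decode-encode x)))

code-cong : {f g : Network q n} → f ≗ g → code f ≡ code g
code-cong {q} {n} f≗g = funToFin-cong {q ^ n} {q ^ n} (cong encode ∘ f≗g ∘ decode)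

code-network : (φ : Fin ((q ^ n) ^ (q ^ n))) → code {q} {n} (network φ) ≡ φ
code-network {q} {n} φ =
  trans (funToFin-cong {q ^ n} {q ^ n} λ j →
          trans (encode-decode {q} {n} (finToFun φ (encode {q} {n} (decode j))))
                (cong (finToFun {q ^ n} {q ^ n} φ) (encode-decode {q} {n} j)))
        (funToFin-finToFin {q ^ n} {q ^ n} φ)

-- Coordinatewise transpositions of letters.

-- Letters are exchanged in each coordinate separately, which is what keeps the interaction graph:
-- transposing `x` and `y` as whole states would also carry `x` to `y`, but could mix coordinates.
swap : (x y : State q n) → State q n → State q n
swap x y s = tabulate λ v → transpose (lookup x v) (lookup y v) (lookup s v)

lookup-swap : (x y s : State q n) (v : Fin n) →
              lookup (swap x y s) v ≡ transpose (lookup x v) (lookup y v) (lookup s v)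
lookup-swap x y s v = lookup∘tabulate _ v

-- A transposition is an involution; the arguments are exchanged to match the form of
-- `transpose-inverse`.
swap-inverse : (x y s : State q n) → swap x y (swap y x s) ≡ s
swap-inverse x y s =
  trans (tabulate-cong λ v →
          trans (cong (transpose (lookup x v) (lookup y v)) (lookup-swap y x s v))
                (transpose-inverse (lookup x v) (lookup y v)))
        (tabulate∘lookup s)

swap-left : (x y : State q n) → swap x y x ≡ y
swap-left x y =
  trans (tabulate-cong λ v → transpose-left (lookup x v) (lookup y v)) (tabulate∘lookup y)
  where
  transpose-left : (i j : Fin n) → transpose i j i ≡ j
  transpose-left i j rewrite dec-true (i ≟ i) refl = refl

-- At each `v` the action on letters is a bijection, undone by the reverse transposition. This
-- supplies the hypothesis of `hasGraph-cong`.
swap-≡⇔ : (x y s t : State q n) (v : Fin n) →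
          lookup s v ≡ lookup t v ⇔ lookup (swap x y s) v ≡ lookup (swap x y t) v
swap-≡⇔ x y s t v = mk⇔
  (λ e → trans (lookup-swap x y s v)
           (trans (cong (transpose _ _) e) (sym (lookup-swap x y t v))))
  (λ e → trans (sym (unswap s)) (trans (cong (transpose _ _) e) (unswap t)))
  where
  unswap : ∀ s → transpose (lookup y v) (lookup x v) (lookup (swap x y s) v) ≡ lookup s v
  unswap s = trans (cong (transpose _ _) (lookup-swap x y s v))
                   (transpose-inverse (lookup y v) (lookup x v))

-- Acts on codes rather than networks: without function extensionality,
-- composing with swap y x and then with swap x y is only pointwise the identity.
swapCodes : (x y : State q n) → Permutation ((q ^ n) ^ (q ^ n)) ((q ^ n) ^ (q ^ n))
swapCodes {q} {n} x y = permutation (post x y) (post y x) (inverse x y) (inverse y x)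
  where
  post : State q n → State q n → Fin ((q ^ n) ^ (q ^ n)) → Fin ((q ^ n) ^ (q ^ n))
  post x y φ = code (swap x y ∘ network φ)
  inverse : ∀ x y φ → post x y (post y x φ) ≡ φ
  inverse x y φ =
    trans (code-cong {f = swap x y ∘ network (code (swap y x ∘ network φ))} {g = network φ}
             λ s → trans (cong (swap x y) (network-code (swap y x ∘ network φ) s))
                         (swap-inverse x y (network φ s)))
          (code-network {q} {n} φ)

-- The mean number of fixed points.

module _ {n : ℕ} (D : Digraph n) (q : ℕ) where

  private
    N M : ℕ
    N = q ^ n
    M = N ^ N

    net : Fin M → Network q n
    net = network

    state : Fin N → State q n
    state = decode

    -- Membership in `F[ D , q ]` becomes a weight on all codes, so that sums run over `Fin M`, the
    -- set permuted by `swapCodes`.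
    member : Fin M → ℕ
    member φ = 𝟙 (hasGraph? D (net φ))

    hits : State q n → State q n → ℕ
    hits z x = ∑[ φ < M ] (member φ * 𝟙 (net φ z ≟ˢ x))

  sum-F : (g : Network q n → ℕ) →
          sum (map g F[ D , q ]) ≡ ∑[ φ < M ] (member φ * g (net φ))
  sum-F g = trans (sum-filter-𝟙 (hasGraph? D) g (networks q n)) (sum-map-allFin _ net)

  length-F : length F[ D , q ] ≡ ∑[ φ < M ] member φ
  length-F = trans (length-filter-𝟙 (hasGraph? D) (networks q n))
                   (sum-map-allFin _ net)

  -- Reindexing by `swapCodes x y` preserves `member` and turns the networks sending `z` to `y` into
  -- those sending `z` to `x`.
  hits-constant : ∀ z x y → hits z x ≡ hits z y
  hits-constant z x y = sym (trans
    (∑-permute (λ φ → member φ * 𝟙 (net φ z ≟ˢ y)) (swapCodes x y))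
    (sum-cong-≗ {M} λ φ → cong₂ _*_ (member-swap φ) (hit-swap φ)))
    where
    swapped : Fin M → Network q n
    swapped φ = net (swapCodes x y ⟨$⟩ʳ φ)

    swapped≡swap : ∀ φ s → swapped φ s ≡ swap x y (net φ s)
    swapped≡swap φ = network-code (swap x y ∘ net φ)

    agree⇔ : ∀ φ v s t →
      lookup (swapped φ s) v ≡ lookup (swapped φ t) v ⇔
      lookup (net φ s) v ≡ lookup (net φ t) v
    agree⇔ φ v s t rewrite swapped≡swap φ s | swapped≡swap φ t =
      ⇔-sym (swap-≡⇔ x y (net φ s) (net φ t) v)

    member-swap : ∀ φ → member (swapCodes x y ⟨$⟩ʳ φ) ≡ member φ
    member-swap φ = 𝟙-cong (hasGraph-cong D (swapped φ) (net φ) (agree⇔ φ))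
                           (hasGraph? D (swapped φ)) (hasGraph? D (net φ))

    hit⇔ : ∀ φ → swapped φ z ≡ y ⇔ net φ z ≡ x
    hit⇔ φ rewrite swapped≡swap φ z = mk⇔
      (λ e → trans (sym (swap-inverse y x (net φ z)))
                   (trans (cong (swap y x) e) (swap-left y x)))
      (λ e → trans (cong (swap x y) e) (swap-left x y))

    hit-swap : ∀ φ → 𝟙 (swapped φ z ≟ˢ y) ≡ 𝟙 (net φ z ≟ˢ x)
    hit-swap φ = 𝟙-cong (hit⇔ φ) (swapped φ z ≟ˢ y) (net φ z ≟ˢ x)

  -- Each network takes exactly one value at `z`, so summing `hits z` over all `N` values counts
  -- every member once; the summands are equal by `hits-constant`.
  N*hits : ∀ z x → N * hits z x ≡ length F[ D , q ]
  N*hits z x = begin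
    N * hits z x
      ≡⟨ ∑-const N (hits z x) ⟨
    ∑[ j < N ] hits z x
      ≡⟨ sum-cong-≗ (λ j → hits-constant z x (state j)) ⟩
    ∑[ j < N ] hits z (state j)
      ≡⟨ ∑-comm (λ j φ → member φ * 𝟙 (net φ z ≟ˢ state j)) ⟩
    ∑[ φ < M ] ∑[ j < N ] (member φ * 𝟙 (net φ z ≟ˢ state j))
      ≡⟨ sum-cong-≗ (λ φ → *-distribˡ-sum (member φ) (λ j → 𝟙 (net φ z ≟ˢ state j))) ⟨
    ∑[ φ < M ] (member φ * ∑[ j < N ] 𝟙 (net φ z ≟ˢ state j))
      ≡⟨ sum-cong-≗ (λ φ → trans (cong (member φ *_) (∑-𝟙-decode (net φ z)))
                              (ℕ.*-identityʳ (member φ))) ⟩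
    ∑[ φ < M ] member φ
      ≡⟨ length-F ⟨
    length F[ D , q ] ∎
    where open ≡-Reasoning

  -- Double counting of the pairs of a network and one of its fixed points.
  ∑-hits : sum (map ∣Fix∣ F[ D , q ]) ≡ ∑[ j < N ] hits (state j) (state j)
  ∑-hits = begin
    sum (map ∣Fix∣ F[ D , q ])
      ≡⟨ sum-F ∣Fix∣ ⟩
    ∑[ φ < M ] (member φ * ∣Fix∣ (net φ))
      ≡⟨ sum-cong-≗ (λ φ → cong (member φ *_) (fix φ)) ⟩
    ∑[ φ < M ] (member φ * ∑[ j < N ] 𝟙 (net φ (state j) ≟ˢ state j))
      ≡⟨ sum-cong-≗ (λ φ → *-distribˡ-sum (member φ) (λ j → 𝟙 (net φ (state j) ≟ˢ state j))) ⟩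
    ∑[ φ < M ] ∑[ j < N ] (member φ * 𝟙 (net φ (state j) ≟ˢ state j))
      ≡⟨ ∑-comm (λ φ j → member φ * 𝟙 (net φ (state j) ≟ˢ state j)) ⟩
    ∑[ j < N ] hits (state j) (state j) ∎
    where
    open ≡-Reasoning
    fix : ∀ φ → ∣Fix∣ (net φ) ≡ ∑[ j < N ] 𝟙 (net φ (state j) ≟ˢ state j)
    fix φ = trans (length-filter-𝟙 (λ x → net φ x ≟ˢ x) (states q n)) (sum-map-allFin _ state)

  -- Each of the `N` states is fixed by a fraction `1 / N` of the networks. Multiplying through by
  -- `N` keeps the argument in the naturals; `q` nonzero allows `N` to be cancelled.
  sum-∣Fix∣ : .{{NonZero q}} → sum (map ∣Fix∣ F[ D , q ]) ≡ length F[ D , q ]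
  sum-∣Fix∣ = ℕ.*-cancelˡ-≡ _ _ N {{ℕ.m^n≢0 q n}} (begin
    N * sum (map ∣Fix∣ F[ D , q ])
      ≡⟨ cong (N *_) ∑-hits ⟩
    N * ∑[ j < N ] hits (state j) (state j)
      ≡⟨ *-distribˡ-sum N (λ j → hits (state j) (state j)) ⟩
    ∑[ j < N ] (N * hits (state j) (state j))
      ≡⟨ sum-cong-≗ {N} (λ j → N*hits (state j) (state j)) ⟩
    ∑[ j < N ] length F[ D , q ]
      ≡⟨ ∑-const N _ ⟩
    N * length F[ D , q ] ∎)
    where open ≡-Reasoning

-- A network with a prescribed interaction graph.

module _ {n : ℕ} (D : Digraph n) (p : ℕ) where

  private
    q′ : ℕ
    q′ = suc (suc p)

    ZeroInNeighbour : State q′ n → Fin n → Set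
    ZeroInNeighbour x v = ∃ λ u → D u v ≡ true × lookup x u ≡ zero

    zeroInNeighbour? : ∀ x v → Dec (ZeroInNeighbour x v)
    zeroInNeighbour? x v = any? λ u → (D u v Bool.≟ true) ×-dec (lookup x u ≟ zero)

  conjunction : Network q′ n
  conjunction x = tabulate λ v → if does (zeroInNeighbour? x v) then zero else suc zero

  private
    lookup-conjunction : ∀ x v →
      lookup (conjunction x) v ≡ (if does (zeroInNeighbour? x v) then zero else suc zero)
    lookup-conjunction x v = lookup∘tabulate _ v

  -- At the all-ones state every coordinate outputs one; putting a zero at the in-neighbour `u`
  -- makes the output at `v` zero.
  conjunction-arc : ∀ u v → D u v ≡ true → InteractionArc conjunction u v
  conjunction-arc u v uv = ones , ones [ u ]≔ zero , (ones≢ , others) , values≢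
    where
    ones : State q′ n
    ones = replicate n (suc zero)

    lookup-ones : ∀ w → lookup ones w ≡ suc zero
    lookup-ones w = lookup-replicate w (suc zero)

    ones≢ : lookup ones u ≢ lookup (ones [ u ]≔ zero) u
    ones≢ e with () ← trans (sym (lookup-ones u)) (trans e (lookup∘update u ones zero))

    others : ∀ w → w ≢ u → lookup ones w ≡ lookup (ones [ u ]≔ zero) w
    others w w≢u = sym (lookup∘update′ w≢u ones zero)

    no-zero : ¬ ZeroInNeighbour ones v
    no-zero (w , _ , e) with () ← trans (sym (lookup-ones w)) e

    values≢ : lookup (conjunction ones) v ≢ lookup (conjunction (ones [ u ]≔ zero)) v
    values≢ rewrite lookup-conjunction ones v
                  | lookup-conjunction (ones [ u ]≔ zero) v
                  | dec-false (zeroInNeighbour? ones v) no-zero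
                  | dec-true (zeroInNeighbour? (ones [ u ]≔ zero) v)
                             (u , uv , lookup∘update u ones zero)
                  = λ ()

  -- If `u` is not an in-neighbour of `v`, two states differing only at `u` agree on all
  -- in-neighbours of `v`, so a zero there occurs in both or in neither.
  conjunction-arc⁻¹ : ∀ u v → InteractionArc conjunction u v → D u v ≡ true
  conjunction-arc⁻¹ u v (x , y , (_ , x≡y) , f≢) with D u v in uv
  ... | true  = refl
  ... | false = contradiction
    (trans (lookup-conjunction x v)
      (trans (cong (if_then zero else suc zero)
                   (does-⇔ (mk⇔ (transfer x y x≡y) (transfer y x λ w w≢u → sym (x≡y w w≢u)))
                           (zeroInNeighbour? x v) (zeroInNeighbour? y v)))
             (sym (lookup-conjunction y v))))
    f≢
    where
    transfer : ∀ x y → (∀ w → w ≢ u → lookup x w ≡ lookup y w) →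
               ZeroInNeighbour x v → ZeroInNeighbour y v
    transfer x y x≡y (w , wv , xw≡0) = w , wv , trans (sym (x≡y w w≢u)) xw≡0
      where
      w≢u : w ≢ u
      w≢u refl with () ← trans (sym uv) wv

  conjunction-hasGraph : HasGraph D conjunction
  conjunction-hasGraph u v = trans
    (does-⇔ (mk⇔ (conjunction-arc⁻¹ u v) (conjunction-arc u v))
            (interactionArc? conjunction u v) (D u v Bool.≟ true))
    (does-≟-true (D u v))
    where
    does-≟-true : ∀ b → does (b Bool.≟ true) ≡ b
    does-≟-true true  = refl
    does-≟-true false = refl

  -- `networks` lists networks only up to pointwise equality, so the member exhibited is
  -- `network (code conjunction)`, and `hasGraph-cong` carries the graph over to it.
  F-nonEmpty : 0 < length F[ D , q′ ]
  F-nonEmpty = filter-some (hasGraph? D)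
    (Any.map⁺ (lose (∈-allFin (code conjunction)) code-hasGraph))
    where
    same : ∀ v x y →
      lookup (conjunction x) v ≡ lookup (conjunction y) v ⇔
      lookup (network (code conjunction) x) v ≡ lookup (network (code conjunction) y) v
    same v x y rewrite network-code conjunction x | network-code conjunction y = mk⇔ id id

    code-hasGraph : HasGraph D (network (code conjunction))
    code-hasGraph = Equivalence.to
      (hasGraph-cong D conjunction (network (code conjunction)) same) conjunction-hasGraph

-- Counting inequalities on lists.

module _ (g : A → ℕ) where

  private
    #0 #1 #2 : List A → ℕ
    #0 = length ∘ filter (λ x → g x ℕ.≟ 0)
    #1 = length ∘ filter (λ x → g x ℕ.≟ 1)
    #2 = length ∘ filter (λ x → 2 ℕ.≤? g x)

  counts-total : ∀ xs → #1 xs + (#0 xs + #2 xs) ≡ length xs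
  counts-total [] = refl
  counts-total (x ∷ xs) with ih ← counts-total xs | g x
  ... | zero        = trans (ℕ.+-suc _ _) (cong suc ih)
  ... | suc zero    = cong suc ih
  ... | suc (suc _) = trans (cong (#1 xs ℕ.+_) (ℕ.+-suc _ _)) (trans (ℕ.+-suc _ _) (cong suc ih))

  -- Termwise, one plus the indicator of `g x ≥ 2` is at most `g x` plus the indicator of `g x = 0`,
  -- with equality for values up to 2. When `g` has mean one, the length and the sum cancel.
  length+#2≤sum+#0 : ∀ xs → length xs + #2 xs ≤ sum (map g xs) + #0 xs
  length+#2≤sum+#0 [] = z≤n
  length+#2≤sum+#0 (x ∷ xs) with ih ← length+#2≤sum+#0 xs | g x
  ... | zero        = ℕ.≤-trans (s≤s ih) (ℕ.≤-reflexive (sym (ℕ.+-suc _ _)))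
  ... | suc zero    = s≤s ih
  ... | suc (suc k) = s≤s (ℕ.≤-trans (ℕ.≤-reflexive (ℕ.+-suc _ _))
      (s≤s (ℕ.≤-trans ih (ℕ.+-monoˡ-≤ (#0 xs) (ℕ.m≤n+m (sum (map g xs)) k)))))

  -- This and `sum≤*#0` squeeze `h` between the indicator of `g x = 0` and `b` times it. They are
  -- applied with `∣Fix∣` for `g`, `i` for `h` and `n` for `b`.
  #0≤sum : (h : A → ℕ) → (∀ x → g x ≡ 0 → 1 ≤ h x) → ∀ xs → #0 xs ≤ sum (map h xs)
  #0≤sum h h≥1 [] = z≤n
  #0≤sum h h≥1 (x ∷ xs) with ih ← #0≤sum h h≥1 xs | g x in gx
  ... | zero  = ℕ.+-mono-≤ (h≥1 x gx) ih
  ... | suc _ = ℕ.≤-trans ih (ℕ.m≤n+m _ (h x))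

  sum≤*#0 : (h : A → ℕ) (b : ℕ) → (∀ x → h x ≤ b) → (∀ x → g x ≢ 0 → h x ≡ 0) →
            ∀ xs → sum (map h xs) ≤ b * #0 xs
  sum≤*#0 h b h≤b h≡0 [] = z≤n
  sum≤*#0 h b h≤b h≡0 (x ∷ xs) with ih ← sum≤*#0 h b h≤b h≡0 xs | g x in gx
  ... | zero  = ℕ.≤-trans (ℕ.+-mono-≤ (h≤b x) ih) (ℕ.≤-reflexive (sym (ℕ.*-suc b _)))
  ... | suc _ rewrite h≡0 x (λ e → contradiction (trans (sym gx) e) λ ()) = ih

-- Distance to the image and fixed points.

d-H-refl : (x : State q n) → d-H x x ≡ 0
d-H-refl {n = n} x = cong length
  (filter-none (λ v → ¬? (lookup x v ≟ lookup x v)) {xs = allFin n}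
               (All.universal (λ v ne → ne refl) _))

d-H-pos : {x y : State q n} → x ≢ y → 1 ≤ d-H x y
d-H-pos {n = n} {x} {y} x≢y with d-H x y in eq
... | suc _ = s≤s z≤n
... | zero  = contradiction
  (trans (sym (tabulate∘lookup x)) (trans (tabulate-cong agree) (tabulate∘lookup y))) x≢y
  where
  agree : ∀ v → lookup x v ≡ lookup y v
  agree v with lookup x v ≟ lookup y v
  ... | yes e = e
  ... | no ne with () ← ℕ.<-irrefl (sym eq)
    (filter-some (λ v → ¬? (lookup x v ≟ lookup y v)) (lose (∈-allFin v) ne))

-- `n` is the default value of `min`, hence an upper bound whatever the distances are.
i≤n : (f : Network q n) → i f ≤ n
i≤n {q} {n} f = min≤⊤ n (map (λ x → d-H x (f x)) (states q n))

i-pos : 1 ≤ n → (f : Network q n) → ∣Fix∣ f ≡ 0 → 1 ≤ i f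
-- The default value `n` takes part in the minimum, so it too must be at least 1.
i-pos {n} {q} 1≤n f fix≡0 = v≤min⁺ 1≤n (All.map⁺ (All.map d-H-pos (All.tabulate unfixed)))
  where
  unfixed : ∀ {x} → _ → x ≢ f x
  unfixed x∈ x≡fx = contradiction fix≡0
    (ℕ.>⇒≢ (filter-some (λ x → f x ≟ˢ x) {xs = states q n} (lose x∈ (sym x≡fx))))

i-zero : (f : Network q n) → ∣Fix∣ f ≢ 0 → i f ≡ 0
i-zero {q} {n} f fix≢0 with Any.any? (λ x → f x ≟ˢ x) (states q n)
-- The bound 0 is reached at a fixed point in the list rather than at the default value, hence
-- `inj₂`.
... | yes fixed = ℕ.n≤0⇒n≡0 (min≤v⁺ n _ (inj₂ (Any.map⁺ (Any.map d≤0 fixed))))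
  where
  d≤0 : ∀ {x} → f x ≡ x → d-H x (f x) ≤ 0
  d≤0 {x} e = ℕ.≤-reflexive (trans (cong (d-H x) e) (d-H-refl x))
... | no none = contradiction
  (cong length (filter-none (λ x → f x ≟ˢ x) (All.¬Any⇒All¬ (states q n) none))) fix≢0

-- Arithmetic of quotients.

-- Unnormalised fractions are compared by cross-multiplication, so statements about `quotient`
-- reduce to integer ones.
toℚᵘ-quotient : ∀ k m → ℚ.toℚᵘ (quotient k (suc m)) ℚᵘ.≃ mkℚᵘ (+ k) m
toℚᵘ-quotient k m = ℚ.toℚᵘ-fromℚᵘ (mkℚᵘ (+ k) m)

quotient-+ : ∀ j k m → quotient (j + k) m ≡ quotient j m ℚ.+ quotient k m
quotient-+ j k zero    = refl
quotient-+ j k (suc m) = ℚ.toℚᵘ-injective (begin-equality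
  ℚ.toℚᵘ (quotient (j + k) (suc m))
    ≃⟨ toℚᵘ-quotient (j + k) m ⟩
  mkℚᵘ (+ (j + k)) m
    ≃⟨ *≡* numerators ⟩
  mkℚᵘ (+ j) m ℚᵘ.+ mkℚᵘ (+ k) m
    ≃⟨ ℚᵘ.+-cong (toℚᵘ-quotient j m) (toℚᵘ-quotient k m) ⟨
  ℚ.toℚᵘ (quotient j (suc m)) ℚᵘ.+ ℚ.toℚᵘ (quotient k (suc m))
    ≃⟨ ℚ.toℚᵘ-homo-+ (quotient j (suc m)) (quotient k (suc m)) ⟨
  ℚ.toℚᵘ (quotient j (suc m) ℚ.+ quotient k (suc m)) ∎)
  where
  open ℚᵘ.≤-Reasoning
  s = + suc m
  -- Unnormalised addition does not reduce: the sum of two fractions over `s` has denominator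
  -- `s * s`.
  numerators : + (j + k) ℤ.* (s ℤ.* s) ≡ (+ j ℤ.* s ℤ.+ + k ℤ.* s) ℤ.* s
  numerators = trans (sym (ℤ.*-assoc (+ (j + k)) s s))
                     (cong (ℤ._* s) (ℤ.*-distribʳ-+ s (+ j) (+ k)))

quotient-monoˡ-≤ : ∀ m {j k} → j ≤ k → quotient j m ℚ.≤ quotient k m
quotient-monoˡ-≤ zero    j≤k = ℚ.≤-refl
quotient-monoˡ-≤ (suc m) {j} {k} j≤k = ℚ.toℚᵘ-cancel-≤ (begin
  ℚ.toℚᵘ (quotient j (suc m))
    ≃⟨ toℚᵘ-quotient j m ⟩
  mkℚᵘ (+ j) m
    ≤⟨ *≤* (ℤ.*-monoʳ-≤-nonNeg (+ suc m) (ℤ.+≤+ j≤k)) ⟩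
  mkℚᵘ (+ k) m
    ≃⟨ toℚᵘ-quotient k m ⟨
  ℚ.toℚᵘ (quotient k (suc m)) ∎)
  where open ℚᵘ.≤-Reasoning

quotient≥0 : ∀ k m → 0ℚ ℚ.≤ quotient k m
quotient≥0 k zero    = ℚ.≤-refl
quotient≥0 k (suc m) = ℚ.nonNegative⁻¹ _ {{ℚ.normalize-nonNeg k (suc m)}}

-- A zero denominator would give 0 by convention; this is where `F-nonEmpty` enters.
quotient-self : ∀ {m} → 0 < m → quotient m m ≡ 1ℚ
quotient-self {suc m} _ = ℚ.toℚᵘ-injective
  (ℚᵘ.≃-trans (toℚᵘ-quotient (suc m) m) (*≡* (ℤ.*-comm (+ suc m) (+ 1))))

quotient-* : ∀ n k m → quotient (n * k) m ≡ quotient n 1 ℚ.* quotient k m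
quotient-* n k zero    = sym (ℚ.*-zeroʳ (quotient n 1))
quotient-* n k (suc m) = ℚ.toℚᵘ-injective (begin-equality
  ℚ.toℚᵘ (quotient (n * k) (suc m))
    ≃⟨ toℚᵘ-quotient (n * k) m ⟩
  mkℚᵘ (+ (n * k)) m
    ≃⟨ *≡* (cong₂ ℤ._*_ (ℤ.pos-* n k) (ℤ.*-identityˡ (+ suc m))) ⟩
  mkℚᵘ (+ n) 0 ℚᵘ.* mkℚᵘ (+ k) m
    ≃⟨ ℚᵘ.*-cong (toℚᵘ-quotient n 0) (toℚᵘ-quotient k m) ⟨
  ℚ.toℚᵘ (quotient n 1) ℚᵘ.* ℚ.toℚᵘ (quotient k (suc m))
    ≃⟨ ℚ.toℚᵘ-homo-* (quotient n 1) (quotient k (suc m)) ⟨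
  ℚ.toℚᵘ (quotient n 1 ℚ.* quotient k (suc m)) ∎)
  where open ℚᵘ.≤-Reasoning

0<1-p : ∀ {p} → p ℚ.< 1ℚ → 0ℚ ℚ.< 1ℚ ℚ.- p
0<1-p {p} p<1 = subst (ℚ._< 1ℚ ℚ.- p) (ℚ.+-inverseʳ p) (ℚ.+-monoˡ-< (ℚ.- p) p<1)

1-p<1 : ∀ {p} → 0ℚ ℚ.< p → 1ℚ ℚ.- p ℚ.< 1ℚ
1-p<1 0<p = ℚ.+-monoʳ-< 1ℚ (ℚ.neg-antimono-< 0<p)

1-p-antimono-≤ : ∀ {p q} → p ℚ.≤ q → 1ℚ ℚ.- q ℚ.≤ 1ℚ ℚ.- p
1-p-antimono-≤ p≤q = ℚ.+-monoʳ-≤ 1ℚ (ℚ.neg-antimono-≤ p≤q)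

½<1 : ½ ℚ.< 1ℚ
½<1 = ℚ.*<* (ℤ.+<+ (s≤s (s≤s z≤n)))

-- Inequalities between the proportions, and the implications.

module _ {n : ℕ} (D : Digraph n) where

  proportions-total : ∀ {q} → 2 ≤ q → p₁ D q ℚ.+ (p₀ D q ℚ.+ p₂ D q) ≡ 1ℚ
  proportions-total {q@(suc (suc p))} (s≤s (s≤s _)) = begin
    p₁ D q ℚ.+ (p₀ D q ℚ.+ p₂ D q)
      ≡⟨ cong (p₁ D q ℚ.+_) (quotient-+ #0 #2 #F) ⟨
    p₁ D q ℚ.+ quotient (#0 + #2) #F
      ≡⟨ quotient-+ #1 (#0 + #2) #F ⟨
    quotient (#1 + (#0 + #2)) #F
      ≡⟨ cong (λ k → quotient k #F) (counts-total ∣Fix∣ F[ D , q ]) ⟩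
    quotient #F #F
      ≡⟨ quotient-self (F-nonEmpty D p) ⟩
    1ℚ ∎
    where
    open ≡-Reasoning
    #0 = length (filter (λ f → ∣Fix∣ f ℕ.≟ 0) F[ D , q ])
    #1 = length (filter (λ f → ∣Fix∣ f ℕ.≟ 1) F[ D , q ])
    #2 = length (filter (λ f → 2 ℕ.≤? ∣Fix∣ f) F[ D , q ])
    #F = length F[ D , q ]

  -- By `sum-∣Fix∣` the counting inequality becomes `#F + #2 ≤ #F + #0`, and `#F` cancels.
  p₂≤p₀ : ∀ {q} → 2 ≤ q → p₂ D q ℚ.≤ p₀ D q
  p₂≤p₀ {q@(suc _)} _ = quotient-monoˡ-≤ #F
    (ℕ.+-cancelˡ-≤ #F #2 #0
      (subst (λ k → #F + #2 ≤ k + #0) (sum-∣Fix∣ D q) (length+#2≤sum+#0 ∣Fix∣ F[ D , q ])))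
    where
    #0 = length (filter (λ f → ∣Fix∣ f ℕ.≟ 0) F[ D , q ])
    #2 = length (filter (λ f → 2 ℕ.≤? ∣Fix∣ f) F[ D , q ])
    #F = length F[ D , q ]

  p₀≤mean-i : 1 ≤ n → ∀ q → p₀ D q ℚ.≤ mean-i D q
  p₀≤mean-i 1≤n q = quotient-monoˡ-≤ (length F[ D , q ])
    (#0≤sum ∣Fix∣ i (i-pos 1≤n) F[ D , q ])

  mean-i≤n*p₀ : ∀ q → mean-i D q ℚ.≤ quotient n 1 ℚ.* p₀ D q
  mean-i≤n*p₀ q = subst (mean-i D q ℚ.≤_)
    (quotient-* n (length (filter (λ f → ∣Fix∣ f ℕ.≟ 0) F[ D , q ])) (length F[ D , q ]))
    (quotient-monoˡ-≤ (length F[ D , q ]) (sum≤*#0 ∣Fix∣ i n i≤n i-zero F[ D , q ]))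

  p₀+p₂≡1-p₁ : ∀ {q} → 2 ≤ q → p₀ D q ℚ.+ p₂ D q ≡ 1ℚ ℚ.- p₁ D q
  p₀+p₂≡1-p₁ {q} 2≤q = trans
    (solve 2 (λ x y → y := x :+ y :- x) refl (p₁ D q) (p₀ D q ℚ.+ p₂ D q))
    (cong (λ x → x ℚ.- p₁ D q) (proportions-total 2≤q))

  a⇒b : Property-a D → Property-b D
  a⇒b (a , 0<a , a<1 , Q , p₂≥a) =
    a , 0<a , a<1 , Q , λ q 2≤q Q≤q → ℚ.≤-trans (p₂≥a q 2≤q Q≤q) (p₂≤p₀ 2≤q)

  -- Dropping the nonnegative `p₂` from `p₁ = 1 - (p₀ + p₂)` leaves `p₁ ≤ 1 - p₀`, whence the
  -- constant `1 - b`.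
  b⇒c : Property-b D → Property-c D
  b⇒c (b , 0<b , b<1 , Q , p₀≥b) =
    1ℚ ℚ.- b , 0<1-p b<1 , 1-p<1 0<b , Q , λ q 2≤q Q≤q → begin
      p₁ D q
        ≡⟨ solve 1 (λ x → x := con 1ℚ :- (con 1ℚ :- x)) refl (p₁ D q) ⟩
      1ℚ ℚ.- (1ℚ ℚ.- p₁ D q)
        ≡⟨ cong (λ x → 1ℚ ℚ.- x) (p₀+p₂≡1-p₁ 2≤q) ⟨
      1ℚ ℚ.- (p₀ D q ℚ.+ p₂ D q)
        ≤⟨ 1-p-antimono-≤ (ℚ.+-monoʳ-≤ (p₀ D q) (quotient≥0 _ (length F[ D , q ]))) ⟩
      1ℚ ℚ.- (p₀ D q ℚ.+ 0ℚ)
        ≡⟨ cong (λ x → 1ℚ ℚ.- x) (ℚ.+-identityʳ (p₀ D q)) ⟩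
      1ℚ ℚ.- p₀ D q
        ≤⟨ 1-p-antimono-≤ (p₀≥b q 2≤q Q≤q) ⟩
      1ℚ ℚ.- b ∎
    where open ℚ.≤-Reasoning

  c⇒b : Property-c D → Property-b D
  c⇒b (c , 0<c , c<1 , Q , p₁≤c) =
    -- `p₀` is at least half of `p₀ + p₂ = 1 - p₁`. In the bounds on the constant, `½ * 0` and
    -- `½ * 1` evaluate to 0 and `½`.
    ½ ℚ.* (1ℚ ℚ.- c) , ℚ.*-monoʳ-<-pos ½ (0<1-p c<1) ,
    ℚ.<-trans (ℚ.*-monoʳ-<-pos ½ (1-p<1 0<c)) ½<1 , Q , λ q 2≤q Q≤q → begin
      ½ ℚ.* (1ℚ ℚ.- c)
        ≤⟨ ℚ.*-monoˡ-≤-nonNeg ½ (1-p-antimono-≤ (p₁≤c q 2≤q Q≤q)) ⟩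
      ½ ℚ.* (1ℚ ℚ.- p₁ D q)
        ≡⟨ cong (½ ℚ.*_) (p₀+p₂≡1-p₁ 2≤q) ⟨
      ½ ℚ.* (p₀ D q ℚ.+ p₂ D q)
        ≤⟨ ℚ.*-monoˡ-≤-nonNeg ½ (ℚ.+-monoʳ-≤ (p₀ D q) (p₂≤p₀ 2≤q)) ⟩
      ½ ℚ.* (p₀ D q ℚ.+ p₀ D q)
        ≡⟨ solve 1 (λ x → con ½ :* (x :+ x) := x) refl (p₀ D q) ⟩
      p₀ D q ∎
    where open ℚ.≤-Reasoning

  b⇒d : 1 ≤ n → Property-b D → Property-d D
  b⇒d 1≤n (b , 0<b , _ , Q , p₀≥b) =
    b , 0<b , Q , λ q 2≤q Q≤q → ℚ.≤-trans (p₀≥b q 2≤q Q≤q) (p₀≤mean-i 1≤n q)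

  -- Dividing `mean-i ≤ n * p₀` by `n`, which is nonzero by `1 ≤ n`, gives `p₀ ≥ d / n`.
  d⇒b : 1 ≤ n → Property-d D → Property-b D
  d⇒b (s≤s {n = m} _) (d , 0<d , Q , mean-i≥d) =
    b , 0<b , ℚ.≤-<-trans (ℚ.p⊓q≤q (1/n ℚ.* d) ½) ½<1 , Q , λ q 2≤q Q≤q → begin
      b
        ≤⟨ ℚ.p⊓q≤p (1/n ℚ.* d) ½ ⟩
      1/n ℚ.* d
        ≤⟨ ℚ.*-monoˡ-≤-nonNeg 1/n {{ℚ.pos⇒nonNeg 1/n}}
           (ℚ.≤-trans (mean-i≥d q 2≤q Q≤q) (mean-i≤n*p₀ q)) ⟩
      1/n ℚ.* (n/1 ℚ.* p₀ D q)
        ≡⟨ ℚ.*-assoc 1/n n/1 (p₀ D q) ⟨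
      1/n ℚ.* n/1 ℚ.* p₀ D q
        ≡⟨ cong (ℚ._* p₀ D q) (ℚ.*-inverseˡ n/1) ⟩
      1ℚ ℚ.* p₀ D q
        ≡⟨ ℚ.*-identityˡ (p₀ D q) ⟩
      p₀ D q ∎
    where
    open ℚ.≤-Reasoning
    n/1 1/n b : ℚ
    n/1 = quotient (suc m) 1
    instance
      n/1-pos : ℚ.Positive n/1
      n/1-pos = ℚ.normalize-pos (suc m) 1
      n/1-nonZero : ℚ.NonZero n/1
      n/1-nonZero = ℚ.pos⇒nonZero n/1
    1/n = ℚ.1/ n/1
    -- The minimum with `½` secures `b < 1`, as (d) states no upper bound on `d`.
    b = (1/n ℚ.* d) ℚ.⊓ ½
    instance
      1/n-pos : ℚ.Positive 1/n
      1/n-pos = ℚ.1/pos⇒pos n/1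
    0<1/n*d : 0ℚ ℚ.< 1/n ℚ.* d
    0<1/n*d = subst (ℚ._< 1/n ℚ.* d) (ℚ.*-zeroʳ 1/n) (ℚ.*-monoʳ-<-pos 1/n 0<d)
    0<b : 0ℚ ℚ.< b
    0<b with ℚ.⊓-sel (1/n ℚ.* d) ½
    ... | inj₁ e = subst (0ℚ ℚ.<_) (sym e) 0<1/n*d
    ... | inj₂ e = subst (0ℚ ℚ.<_) (sym e) (ℚ.positive⁻¹ ½)

proposition4p4 : (n : ℕ) → 1 ≤ n → (D : Digraph n) →
    (Property-a D → Property-b D) ×
    (Property-b D ⇔ Property-c D) ×
    (Property-c D ⇔ Property-d D)
proposition4p4 n 1≤n D =
  a⇒b D , mk⇔ (b⇒c D) (c⇒b D) , mk⇔ (b⇒d D 1≤n ∘ c⇒b D) (b⇒c D ∘ d⇒b D 1≤n)
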